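{- Consider the sequence game (defined in the context), in a position $(n_1,\dots,n_k)$ consisting of a finite sequence of positive integers with $\sum_{i=1}^k n_i\ge 2$. If it is White's turn (that is, $\sum_{i=1}^k n_i$ is odd), then White wins if and only if $|\Delta(n_1,\dots,n_k)|=1$. If it is Black's turn (that is, $\sum_{i=1}^k n_i$ is even), then Black wins if and only if $|\Delta(n_1,\dots,n_k)|\ne 0$.
   Context: Sequence game: a position is a finite sequence $(n_1,\dots,n_k)$ of positive integers with $\sum_{i=1}^k n_i\ge 2$. There are two players, Black and White, who alternate; it is Black's turn when $\sum n_i$ is even and White's turn when $\sum n_i$ is odd. At each turn, the player to move replaces the ordered sequence by a new one through one of the following moves: (i) replace $n_1$ by $n_1-1$, if $n_1\ge 2$; (ii) replace $n_k$ by $n_k-1$, if $n_k\ge 2$; (iii) remove some $n_i$ with $n_i=1$; (iv) choose some $n_i\ge 3$ and replace it by a pair $(n',n'')$ of positive integers (in consecutive positions) with $n'+n''=n_i-1$; (v) replace two consecutive terms $(n_i,n_{i+1})$ with $n_i+n_{i+1}\ge 3$ by the single term $n_i+n_{i+1}-1$. Each move decreases $\sum n_i$ by $1$. The game ends when $\sum n_i=2$: White is the winner if the final sequence is $(2)$, and Black is the winner if the final sequence is $(1,1)$. "A player wins" in a position means that the player has a winning strategy from that position. The integer $\Delta$ is defined by $$\Delta(n_1,\dots,n_k)=\bigl|\{i: n_i \text{ odd and } |\{j\le i: n_j \text{ even}\}| \text{ is even}\}\bigr|-\bigl|\{i: n_i \text{ odd and } |\{j\le i: n_j \text{ even}\}|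 \text{ is odd}\}\bigr|.$$ -}

module Defs where

open import Data.Nat.Base using (ℕ; _+_; _∸_; _≤_; parity)
open import Data.Integer.Base using (ℤ; _⊖_)
open import Data.Fin.Base using (Fin)
import Data.Fin.Properties as Fin
open import Data.List.Base
  using (List; []; _∷_; _++_; _∷ʳ_; length; lookup; filter; allFin)
open import Data.Nat.ListAction using (sum)
open import Data.Parity.Base using (Parity; 0ℙ; 1ℙ)
import Data.Parity.Properties as Parity
open import Relation.Binary.PropositionalEquality using (_≡_; _≢_)
open import Relation.Nullary.Decidable using (_×-dec_)
open import Relation.Unary using (Pred; Decidable)
open import Level using (Level)

Even Odd : ℕ → Set
Even n = parity n ≡ 0ℙ
Odd  n = parity n ≡ 1ℙ

even? : Decidable Even
even? n = parity n Parity.≟ 0ℙ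

odd? : Decidable Odd
odd? n = parity n Parity.≟ 1ℙ

data Player : Set where
  Black White : Player

mover : Parity → Player
mover 0ℙ = Black
mover 1ℙ = White

turn : List ℕ → Player
turn ns = mover (parity (sum ns))

-- Both players have the same moves.  Every move preserves positivity of the
-- entries, so the positions reachable from a list of positive integers are
-- again lists of positive integers.
infix 4 _⟶_
data _⟶_ : List ℕ → List ℕ → Set where
  decrementFirst : ∀ {n ns} → 2 ≤ n → n ∷ ns ⟶ (n ∸ 1) ∷ ns
  decrementLast  : ∀ {ns n} → 2 ≤ n → ns ∷ʳ n ⟶ ns ∷ʳ (n ∸ 1)
  remove         : ∀ {ls rs} → ls ++ 1 ∷ rs ⟶ ls ++ rs
  split          : ∀ {ls n n′ n″ rs} → 3 ≤ n → 1 ≤ n′ → 1 ≤ n″ →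
                   n′ + n″ ≡ n ∸ 1 →
                   ls ++ n ∷ rs ⟶ ls ++ n′ ∷ n″ ∷ rs
  merge          : ∀ {ls m n rs} → 3 ≤ m + n →
                   ls ++ m ∷ n ∷ rs ⟶ ls ++ (m + n ∸ 1) ∷ rs

data FinalWin : Player → List ℕ → Set where
  white : FinalWin White (2 ∷ [])
  black : FinalWin Black (1 ∷ 1 ∷ [])

-- An element of `Wins p ns` is a winning strategy for p from ns, as a
-- well-founded tree: it fixes one move whenever p is to move, has a branch for
-- every move of the opponent, and all its leaves are final positions won by p.
-- The vacuous case of `respond` does not arise: a list of positive integers
-- with sum at least 3 always admits a move.
data Wins (p : Player) : List ℕ → Set where
  final   : ∀ {ns} → FinalWin p ns → Wins p ns
  choose  : ∀ {ns ms} → 3 ≤ sum ns → turn ns ≡ p →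
            ns ⟶ ms → Wins p ms → Wins p ns
  respond : ∀ {ns} → 3 ≤ sum ns → turn ns ≢ p →
            (∀ {ms} → ns ⟶ ms → Wins p ms) → Wins p ns

count : ∀ {k} {ℓ : Level} {P : Pred (Fin k) ℓ} → Decidable P → ℕ
count {k} P? = length (filter P? (allFin k))

evensUpTo : (ns : List ℕ) → Fin (length ns) → ℕ
evensUpTo ns i = count λ j → (j Fin.≤? i) ×-dec even? (lookup ns j)

-- a ⊖ b is the integer difference of the naturals a and b.
Δ : List ℕ → ℤ
Δ ns = count (λ i → odd? (lookup ns i) ×-dec even? (evensUpTo ns i))
     ⊖ count (λ i → odd? (lookup ns i) ×-dec odd?  (evensUpTo ns i))

{-# OPTIONS --safe #-}

-- Every move changes |Δ| by exactly one, so Black cannot leave Δ = 0 without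
-- handing White |Δ| = 1, and White cannot reach Δ = 0 from |Δ| ≥ 3.  The
-- remaining cases need a good move for the player who should win.  Acting on
-- the first term (removing it if it is 1, decrementing it otherwise) turns |Δ|
-- into |1 - Δ|: White uses it when Δ = 1 and Black when Δ < 0.  Unless all terms
-- are 1, the first term n other than 1 lets Δ be raised by one: split n into
-- (1, n - 2) if n ≥ 3; if n = 2, merge it with its successor, or decrement it if
-- it is last.  White uses it when Δ = -1 and Black when Δ > 0.  If all terms are
-- 1, then Δ is the sum, and removing a term keeps Black winning.
module Submission where

open import Defs
open import Data.Fin.Base as Fin using (Fin; zero; suc)
import Data.Fin.Properties as Fin
open import Data.Integer.Base as ℤ using (ℤ; -[1+_]; -_; 0ℤ; 1ℤ; _⊖_; ∣_∣)
import Data.Integer.Properties as ℤ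
open import Data.List.Base
  using (List; []; _∷_; _++_; _∷ʳ_; length; lookup; filter; map; tabulate; allFin)
open import Data.List.Properties using (++-assoc; filter-≐; filter-none; map-tabulate)
open import Data.List.Relation.Unary.All as All using (All; []; _∷_)
import Data.List.Relation.Unary.All.Properties as All
open import Data.Nat.Base
  using (ℕ; zero; suc; _+_; _∸_; _≤_; z≤n; s≤s; s≤s⁻¹; parity)
open import Data.Nat.ListAction using (sum)
import Data.Nat.Properties as ℕ
open import Data.Parity.Base as ℙ using (Parity; 0ℙ; 1ℙ; _⁻¹)
import Data.Parity.Properties as ℙ
open import Data.Product.Base using (_×_; _,_; ∃-syntax)
open import Data.Sum.Base using (_⊎_; inj₁; inj₂; swap)
open import Function.Base using (id; _∘_)
open import Function.Bundles using (_⇔_; mk⇔)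
open import Level using (Level)
open import Relation.Binary.PropositionalEquality
  using (_≡_; _≢_; refl; sym; trans; cong; cong₂; subst; subst₂)
open import Relation.Nullary using (¬_; yes; no; contradiction)
open import Relation.Nullary.Decidable using (_×-dec_)
open import Relation.Unary using (Pred; Decidable; _≐_)

private
  variable
    a ℓ ℓ′ : Level
    A B : Set a

-- Counting

length-filter-map : {P : Pred B ℓ} (P? : Decidable P) (f : A → B) (xs : List A) →
                    length (filter P? (map f xs)) ≡ length (filter (P? ∘ f) xs)
length-filter-map P? f []       = refl
length-filter-map P? f (x ∷ xs) with P? (f x)
... | yes _ = cong suc (length-filter-map P? f xs)
... | no  _ = length-filter-map P? f xs

count-≐ : ∀ {k} {P : Pred (Fin k) ℓ} {Q : Pred (Fin k) ℓ′}
          (P? : Decidable P) (Q? : Decidable Q) → P ≐ Q → count P? ≡ count Q?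
count-≐ P? Q? P≐Q = cong length (filter-≐ P? Q? P≐Q (allFin _))

module _ {k : ℕ} {P : Pred (Fin (suc k)) ℓ} (P? : Decidable P) where

  -- The tail of `allFin (suc k)` is `tabulate suc`, that is, `suc` mapped over `allFin k`, so
  -- counting over it only reindexes the predicate.
  count-tail : length (filter P? (tabulate suc)) ≡ count (P? ∘ suc)
  count-tail = trans (cong (length ∘ filter P?) (sym (map-tabulate id suc)))
                     (length-filter-map P? suc (allFin k))

  count-accept : {Q : Pred (Fin k) ℓ′} (Q? : Decidable Q) →
                 P zero → P ∘ suc ≐ Q → count P? ≡ suc (count Q?)
  count-accept Q? p P≐Q with P? zero
  ... | yes _ = cong suc (trans count-tail (count-≐ (P? ∘ suc) Q? P≐Q))
  ... | no ¬p = contradiction p ¬p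

  count-reject : {Q : Pred (Fin k) ℓ′} (Q? : Decidable Q) →
                 ¬ P zero → P ∘ suc ≐ Q → count P? ≡ count Q?
  count-reject Q? ¬p P≐Q with P? zero
  ... | yes p = contradiction p ¬p
  ... | no _  = trans count-tail (count-≐ (P? ∘ suc) Q? P≐Q)

count-none : ∀ {k} {P : Pred (Fin k) ℓ} (P? : Decidable P) →
             (∀ i → ¬ P i) → count P? ≡ 0
count-none P? ¬P = cong length (filter-none P? {xs = allFin _} (All.tabulate (λ {i} _ → ¬P i)))

-- Δ as a recursive function

parity-suc : ∀ n → parity (suc n) ≡ parity n ⁻¹
parity-suc n = sym (ℙ.⁻¹-selfInverse (ℙ.suc-homo-⁻¹ n))

-- How a term acts on the Δ of what follows it: an even term flips the sign of every later odd term,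
-- while an odd term has no even term before it and so counts as plus one.
signStep : Parity → ℤ → ℤ
signStep 0ℙ z = - z
signStep 1ℙ z = ℤ.suc z

signedOdds : List ℕ → ℤ
signedOdds []       = 0ℤ
signedOdds (n ∷ ns) = signStep (parity n) (signedOdds ns)

¬even×odd : ∀ n → Even n → ¬ Odd n
¬even×odd n e o with () ← trans (sym e) o

EvenUpTo : ∀ ns → Fin (length ns) → Pred (Fin (length ns)) _
EvenUpTo ns i j = j Fin.≤ i × Even (lookup ns j)

evenUpTo? : ∀ ns i → Decidable (EvenUpTo ns i)
evenUpTo? ns i j = (j Fin.≤? i) ×-dec even? (lookup ns j)

OddSigned : Parity → ∀ ns → Pred (Fin (length ns)) _
OddSigned p ns i = Odd (lookup ns i) × parity (evensUpTo ns i) ≡ p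

oddSigned? : ∀ p ns → Decidable (OddSigned p ns)
oddSigned? p ns i = odd? (lookup ns i) ×-dec (parity (evensUpTo ns i) ℙ.≟ p)

module _ (n : ℕ) (ns : List ℕ) where

  private
    tail-≐ : ∀ i → EvenUpTo (n ∷ ns) (suc i) ∘ suc ≐ EvenUpTo ns i
    tail-≐ i = (λ (j≤i , e) → s≤s⁻¹ j≤i , e) , (λ (j≤i , e) → s≤s j≤i , e)

  evensUpTo-even-suc : Even n → ∀ i → evensUpTo (n ∷ ns) (suc i) ≡ suc (evensUpTo ns i)
  evensUpTo-even-suc e i =
    count-accept (evenUpTo? (n ∷ ns) (suc i)) (evenUpTo? ns i) (z≤n , e) (tail-≐ i)

  evensUpTo-odd-zero : Odd n → evensUpTo (n ∷ ns) zero ≡ 0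
  evensUpTo-odd-zero o = count-none (evenUpTo? (n ∷ ns) zero) λ where
    zero (_ , e) → ¬even×odd n e o

  evensUpTo-odd-suc : Odd n → ∀ i → evensUpTo (n ∷ ns) (suc i) ≡ evensUpTo ns i
  evensUpTo-odd-suc o i =
    count-reject (evenUpTo? (n ∷ ns) (suc i)) (evenUpTo? ns i)
                 (λ (_ , e) → ¬even×odd n e o) (tail-≐ i)

  -- An even head is not counted itself and raises every later even-count by one, so the two sign
  -- classes trade places.
  count-even-∷ : Even n → ∀ p →
    count (oddSigned? p (n ∷ ns)) ≡ count (oddSigned? (p ⁻¹) ns)
  count-even-∷ e p =
    count-reject (oddSigned? p (n ∷ ns)) (oddSigned? (p ⁻¹) ns)
      (λ (o , _) → ¬even×odd n e o)
      ( (λ {i} (o , eq) → o , sym (ℙ.⁻¹-selfInverse (trans (sym (flipped i)) eq)))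
      , (λ {i} (o , eq) → o , trans (flipped i) (ℙ.⁻¹-selfInverse (sym eq))))
    where
    flipped : ∀ i → parity (evensUpTo (n ∷ ns) (suc i)) ≡ parity (evensUpTo ns i) ⁻¹
    flipped i = trans (cong parity (evensUpTo-even-suc e i)) (parity-suc (evensUpTo ns i))

  module _ (o : Odd n) where

    private
      tail-signed-≐ : ∀ p → OddSigned p (n ∷ ns) ∘ suc ≐ OddSigned p ns
      tail-signed-≐ p =
        (λ {i} (o′ , eq) → o′ , trans (cong parity (sym (evensUpTo-odd-suc o i))) eq) ,
        (λ {i} (o′ , eq) → o′ , trans (cong parity (evensUpTo-odd-suc o i)) eq)

    count-odd-∷-plus : count (oddSigned? 0ℙ (n ∷ ns)) ≡ suc (count (oddSigned? 0ℙ ns))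
    count-odd-∷-plus =
      count-accept (oddSigned? 0ℙ (n ∷ ns)) (oddSigned? 0ℙ ns)
        (o , cong parity (evensUpTo-odd-zero o)) (tail-signed-≐ 0ℙ)

    count-odd-∷-minus : count (oddSigned? 1ℙ (n ∷ ns)) ≡ count (oddSigned? 1ℙ ns)
    count-odd-∷-minus =
      count-reject (oddSigned? 1ℙ (n ∷ ns)) (oddSigned? 1ℙ ns)
        (λ (_ , eq) → ¬even×odd (evensUpTo (n ∷ ns) zero) (cong parity (evensUpTo-odd-zero o)) eq)
        (tail-signed-≐ 1ℙ)

  Δ-∷ : ∀ {p} → parity n ≡ p → Δ (n ∷ ns) ≡ signStep p (Δ ns)
  Δ-∷ {0ℙ} e = trans (cong₂ _⊖_ (count-even-∷ e 0ℙ) (count-even-∷ e 1ℙ))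
    (ℤ.⊖-swap (count (oddSigned? 1ℙ ns)) (count (oddSigned? 0ℙ ns)))
  Δ-∷ {1ℙ} o = trans (cong₂ _⊖_ (count-odd-∷-plus o) (count-odd-∷-minus o))
    (sym (ℤ.distribʳ-⊖-+-pos 1 (count (oddSigned? 0ℙ ns)) (count (oddSigned? 1ℙ ns))))

Δ≡signedOdds : ∀ ns → Δ ns ≡ signedOdds ns
Δ≡signedOdds []       = refl
Δ≡signedOdds (n ∷ ns) = trans (Δ-∷ n ns refl) (cong (signStep (parity n)) (Δ≡signedOdds ns))

-- The effect of a move on |Δ|

infix 4 _~_
data _~_ (x y : ℤ) : Set where
  up   : y ≡ ℤ.suc x → x ~ y
  down : x ≡ ℤ.suc y → x ~ y

~-sym : ∀ {x y} → x ~ y → y ~ x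
~-sym (up eq)   = down eq
~-sym (down eq) = up eq

suc-neg-suc : ∀ z → - z ≡ ℤ.suc (- ℤ.suc z)
suc-neg-suc z = sym (trans (cong ℤ.suc (ℤ.neg-distrib-+ 1ℤ z))
                           (ℤ.suc-pred (- z)))

signStep-~ : ∀ p {x y} → x ~ y → signStep p x ~ signStep p y
signStep-~ 0ℙ {x}     (up refl) = down (suc-neg-suc x)
signStep-~ 0ℙ {y = y} (down refl) = up (suc-neg-suc y)
signStep-~ 1ℙ         (up refl) = up refl
signStep-~ 1ℙ         (down refl) = down refl

signStep-⁻¹ : ∀ p → signStep p 0ℤ ~ signStep (p ⁻¹) 0ℤ
signStep-⁻¹ 0ℙ = up refl
signStep-⁻¹ 1ℙ = down refl

-- As functions of `z`, both sides carry the same sign, and their constant terms differ by one.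
signStep-split : ∀ p q z → signStep ((p ℙ.+ q) ⁻¹) z ~ signStep p (signStep q z)
signStep-split 0ℙ 0ℙ z = down (cong ℤ.suc (sym (ℤ.neg-involutive z)))
signStep-split 0ℙ 1ℙ z = down (suc-neg-suc z)
signStep-split 1ℙ 0ℙ z = up refl
signStep-split 1ℙ 1ℙ z = up refl

signedOdds-++⁺ : ∀ ls {rs ts} → signedOdds rs ~ signedOdds ts →
                 signedOdds (ls ++ rs) ~ signedOdds (ls ++ ts)
signedOdds-++⁺ []       r~t = r~t
signedOdds-++⁺ (l ∷ ls) r~t = signStep-~ (parity l) (signedOdds-++⁺ ls r~t)

parity-suc-+ : ∀ m n → parity (suc (m + n)) ≡ (parity m ℙ.+ parity n) ⁻¹
parity-suc-+ m n = trans (parity-suc (m + n)) (cong _⁻¹ (ℙ.+-homo-+ m n))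

signedOdds-split : ∀ m n rs →
                   signedOdds (suc (m + n) ∷ rs) ~ signedOdds (m ∷ n ∷ rs)
signedOdds-split m n rs rewrite parity-suc-+ m n =
  signStep-split (parity m) (parity n) (signedOdds rs)

signedOdds-merge : ∀ {m n} → 3 ≤ m + n → ∀ rs →
                   signedOdds (m ∷ n ∷ rs) ~ signedOdds ((m + n ∸ 1) ∷ rs)
signedOdds-merge {m} {n} 3≤m+n rs
  with signStep-split (parity m) (parity n) (signedOdds rs)
-- Merging reverses splitting up to parity: `m + n ∸ 1` and `suc (m + n)` agree mod 2,
-- definitionally once `m + n` is a successor.
... | s rewrite sym (parity-suc-+ m n) with m + n | 3≤m+n
... | suc _ | _ = ~-sym s

-- Flipping the parity of the head exchanges z ↦ -z with z ↦ 1 + z, and x ↦ 1 - x carries either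
-- value to the other.
signedOdds-decrementFirst : ∀ n ns →
  signedOdds (n ∷ ns) ≡ ℤ.suc (- signedOdds (suc n ∷ ns))
signedOdds-decrementFirst n ns rewrite parity-suc n with parity n
... | 0ℙ = suc-neg-suc (signedOdds ns)
... | 1ℙ = cong ℤ.suc (sym (ℤ.neg-involutive (signedOdds ns)))

∣suc∣ : ∀ z → ∣ ℤ.suc z ∣ ≡ suc ∣ z ∣ ⊎ ∣ z ∣ ≡ suc ∣ ℤ.suc z ∣
∣suc∣ (ℤ.+ _)      = inj₁ refl
∣suc∣ -[1+ zero ]  = inj₂ refl
∣suc∣ -[1+ suc _ ] = inj₂ refl

∣∣-~ : ∀ {x y} → x ~ y → ∣ y ∣ ≡ suc ∣ x ∣ ⊎ ∣ x ∣ ≡ suc ∣ y ∣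
∣∣-~ {x} (up refl)       = ∣suc∣ x
∣∣-~ {y = y} (down refl) = swap (∣suc∣ y)

∣signedOdds∣-⟶ : ∀ {ns ms} → ns ⟶ ms →
  ∣ signedOdds ms ∣ ≡ suc ∣ signedOdds ns ∣ ⊎ ∣ signedOdds ns ∣ ≡ suc ∣ signedOdds ms ∣
∣signedOdds∣-⟶ (decrementFirst {suc n} {ns} _)
  -- This move reflects Δ to 1 - Δ, which is one more than -Δ; hence -Δ is used in place of Δ.
  rewrite sym (ℤ.∣-i∣≡∣i∣ (signedOdds (suc n ∷ ns))) =
  ∣∣-~ {x = - signedOdds (suc n ∷ ns)} (up (signedOdds-decrementFirst n ns))
∣signedOdds∣-⟶ (decrementLast {ns} {suc n} _) =
  -- Nothing follows the last term, so its own contribution just switches between 0 and 1.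
  ∣∣-~ (signedOdds-++⁺ ns
    (subst (λ p → signStep (parity (suc n)) 0ℤ ~ signStep p 0ℤ)
           (ℙ.suc-homo-⁻¹ n) (signStep-⁻¹ (parity (suc n)))))
∣signedOdds∣-⟶ (remove {ls}) = ∣∣-~ (signedOdds-++⁺ ls (down refl))
∣signedOdds∣-⟶ (split {ls} {suc n} {m} {m′} {rs} _ _ _ refl) =
  ∣∣-~ (signedOdds-++⁺ ls (signedOdds-split m m′ rs))
∣signedOdds∣-⟶ (merge {ls} {m} {n} {rs} 3≤m+n) =
  ∣∣-~ (signedOdds-++⁺ ls (signedOdds-merge {m} {n} 3≤m+n rs))

parity-∣suc∣ : ∀ z → parity ∣ ℤ.suc z ∣ ≡ parity ∣ z ∣ ⁻¹
parity-∣suc∣ (ℤ.+ n)      = parity-suc n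
parity-∣suc∣ -[1+ zero ]  = refl
parity-∣suc∣ -[1+ suc n ] = parity-suc n

-- Signs vanish mod 2, so both sides reduce to the number of odd terms.
parity-∣signedOdds∣ : ∀ ns → parity ∣ signedOdds ns ∣ ≡ parity (sum ns)
parity-∣signedOdds∣ []       = refl
parity-∣signedOdds∣ (n ∷ ns) rewrite ℙ.+-homo-+ n (sum ns) with parity n
... | 0ℙ = trans (cong parity (ℤ.∣-i∣≡∣i∣ (signedOdds ns))) (parity-∣signedOdds∣ ns)
... | 1ℙ = trans (parity-∣suc∣ (signedOdds ns)) (cong _⁻¹ (parity-∣signedOdds∣ ns))

-- Moves, sums and positivity

sum-++-suc : ∀ ls {rs ts} → sum rs ≡ suc (sum ts) → sum (ls ++ rs) ≡ suc (sum (ls ++ ts))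
sum-++-suc []       eq = eq
sum-++-suc (l ∷ ls) eq = trans (cong (l +_) (sum-++-suc ls eq)) (ℕ.+-suc l _)

sum-⟶ : ∀ {ns ms} → ns ⟶ ms → sum ns ≡ suc (sum ms)
sum-⟶ (decrementFirst {suc n} _)                     = refl
sum-⟶ (decrementLast {ns} {suc n} _)                 = sum-++-suc ns refl
sum-⟶ (remove {ls})                                  = sum-++-suc ls refl
sum-⟶ (split {ls} {suc _} {m} {m′} {rs} _ _ _ refl)  =
  sum-++-suc ls (cong suc (ℕ.+-assoc m m′ (sum rs)))
sum-⟶ (merge {ls} {m} {n} {rs} 3≤m+n)                = sum-++-suc ls
  (trans (sym (ℕ.+-assoc m n (sum rs)))
         (cong (_+ sum rs) (sym (ℕ.m+[n∸m]≡n (ℕ.≤-trans (s≤s z≤n) 3≤m+n)))))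

Positive : List ℕ → Set
Positive = All (1 ≤_)

positive-++⁺ : ∀ ls {rs ts} → (Positive rs → Positive ts) →
               Positive (ls ++ rs) → Positive (ls ++ ts)
positive-++⁺ ls f ps = All.++⁺ (All.++⁻ˡ ls ps) (f (All.++⁻ʳ ls ps))

positive-⟶ : ∀ {ns ms} → ns ⟶ ms → Positive ns → Positive ms
positive-⟶ (decrementFirst 2≤n)       (_ ∷ ps) = ℕ.∸-monoˡ-≤ 1 2≤n ∷ ps
positive-⟶ (decrementLast {ns} 2≤n)            =
  positive-++⁺ ns λ { (_ ∷ ps) → ℕ.∸-monoˡ-≤ 1 2≤n ∷ ps }
positive-⟶ (remove {ls})                       = positive-++⁺ ls λ { (_ ∷ ps) → ps }
positive-⟶ (split {ls} _ 1≤m 1≤m′ _)           =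
  positive-++⁺ ls λ { (_ ∷ ps) → 1≤m ∷ 1≤m′ ∷ ps }
positive-⟶ (merge {ls} 3≤m+n)                  =
  positive-++⁺ ls λ { (_ ∷ _ ∷ ps) →
    ℕ.≤-trans (s≤s z≤n) (ℕ.∸-monoˡ-≤ 1 3≤m+n) ∷ ps }

-- Good moves

-- Removing a leading 1 gives Δ - 1 and decrementing gives 1 - Δ; only the absolute value is common
-- to both.
moveFirst : ∀ {ns} → Positive ns → 1 ≤ sum ns →
  ∃[ ms ] (ns ⟶ ms) × ∣ signedOdds ms ∣ ≡ ∣ ℤ.suc (- signedOdds ns) ∣
moveFirst {0 ∷ _} (() ∷ _) _
moveFirst {1 ∷ ns} _ _ =
  ns , remove {[]} ,
  trans (sym (ℤ.∣-i∣≡∣i∣ (signedOdds ns))) (cong ∣_∣ (suc-neg-suc (signedOdds ns)))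
moveFirst {suc (suc n) ∷ ns} _ _ =
  suc n ∷ ns , decrementFirst (s≤s (s≤s z≤n)) ,
  cong ∣_∣ (signedOdds-decrementFirst (suc n) ns)

-- The move must survive any prefix ls so that stripped leading 1s can be put back.
Raise : List ℕ → Set
Raise ns = ∃[ ms ] (∀ ls → ls ++ ns ⟶ ls ++ ms) × signedOdds ms ≡ ℤ.suc (signedOdds ns)

raise-∷ : ∀ {ns} → Raise ns → Raise (1 ∷ ns)
raise-∷ {ns} (ms , move , eq) =
  1 ∷ ms ,
  (λ ls → subst₂ _⟶_ (++-assoc ls (1 ∷ []) ns) (++-assoc ls (1 ∷ []) ms) (move (ls ∷ʳ 1))) ,
  cong ℤ.suc eq

raise-or-ones : ∀ {ns} → Positive ns → Raise ns ⊎ All (1 ≡_) ns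
raise-or-ones {[]}                  []       = inj₂ []
raise-or-ones {1 ∷ _}               (_ ∷ ps) with raise-or-ones ps
... | inj₁ r  = inj₁ (raise-∷ r)
... | inj₂ os = inj₂ (refl ∷ os)
raise-or-ones {2 ∷ []}              _        =
  inj₁ (1 ∷ [] , (λ ls → decrementLast {ls} ℕ.≤-refl) , refl)
raise-or-ones {2 ∷ n ∷ ns}          (_ ∷ 1≤n ∷ _) =
  -- The 2 negates the Δ of the rest, x, to -x; absorbing it flips the parity of `n` instead, giving
  -- 1 - x.
  inj₁ (suc n ∷ ns , (λ ls → merge {ls} {2} (s≤s (s≤s 1≤n))) , raised)
  where
  raised : signedOdds (suc n ∷ ns) ≡ ℤ.suc (signedOdds (2 ∷ n ∷ ns))
  raised rewrite parity-suc n with parity n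
  ... | 0ℙ = cong ℤ.suc (sym (ℤ.neg-involutive (signedOdds ns)))
  ... | 1ℙ = suc-neg-suc (signedOdds ns)
raise-or-ones {suc (suc (suc n)) ∷ ns} _     =
  -- The part `suc n` keeps the parity of the original term, so the new leading 1 accounts for the
  -- whole change.
  inj₁ (1 ∷ suc n ∷ ns ,
        (λ ls → split {ls} (s≤s (s≤s (s≤s z≤n))) (s≤s z≤n) (s≤s z≤n) refl) , refl)

signedOdds-ones : ∀ {ns} → All (1 ≡_) ns → signedOdds ns ≡ ℤ.+ sum ns
signedOdds-ones []          = refl
signedOdds-ones (refl ∷ os) = cong ℤ.suc (signedOdds-ones os)

-- The game

-- The arguments are the parity of the sum and |Δ|. These have equal parity in every position, so
-- the values at `0ℙ`, `1` and at `1ℙ`, `0` are mere defaults.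
winner : Parity → ℕ → Player
winner 0ℙ 0       = White
winner 0ℙ (suc _) = Black
winner 1ℙ 1       = White
winner 1ℙ _       = Black

other : Player → Player
other Black = White
other White = Black

≢⇒≡other : ∀ {p q} → q ≢ p → p ≡ other q
≢⇒≡other {Black} {Black} q≢p = contradiction refl q≢p
≢⇒≡other {Black} {White} _   = refl
≢⇒≡other {White} {Black} _   = refl
≢⇒≡other {White} {White} q≢p = contradiction refl q≢p

final-sum : ∀ {p ns} → FinalWin p ns → sum ns ≡ 2
final-sum white = refl
final-sum black = refl

¬final : ∀ {p ns} {C : Set} → FinalWin p ns → 3 ≤ sum ns → C
¬final f 3≤ with () ← ℕ.<-irrefl (sym (final-sum f)) 3≤

-- Playing the two strategies against each other leads to a single final position, which has one
-- winner. This yields the "only if" directions of the theorem.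
wins-unique : ∀ {p q ns} → Wins p ns → Wins q ns → p ≡ q
wins-unique (final white)        (final white)          = refl
wins-unique (final black)        (final black)          = refl
wins-unique (final f)            (choose 3≤ _ _ _)      = ¬final f 3≤
wins-unique (final f)            (respond 3≤ _ _)       = ¬final f 3≤
wins-unique (choose 3≤ _ _ _)    (final f)              = ¬final f 3≤
wins-unique (respond 3≤ _ _)     (final f)              = ¬final f 3≤
wins-unique (choose _ t _ _)     (choose _ t′ _ _)      = trans (sym t) t′
wins-unique (choose _ _ move w)  (respond _ _ w′)       = wins-unique w (w′ move)
wins-unique (respond _ _ w)      (choose _ _ move w′)   = wins-unique (w move) w′
wins-unique (respond _ t _)      (respond _ t′ _)       =
  trans (≢⇒≡other t) (sym (≢⇒≡other t′))

predictedWinner : List ℕ → Player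
predictedWinner ns = winner (parity (sum ns)) ∣ signedOdds ns ∣

predictedWinner-final : ∀ {ns} → Positive ns → sum ns ≡ 2 → FinalWin (predictedWinner ns) ns
predictedWinner-final {2 ∷ []}              _                  _ = white
predictedWinner-final {1 ∷ 1 ∷ []}          _                  _ = black
predictedWinner-final {0 ∷ _}               (() ∷ _)           _
predictedWinner-final {1 ∷ 0 ∷ _}           (_ ∷ () ∷ _)       _
predictedWinner-final {1 ∷ 1 ∷ 0 ∷ _}       (_ ∷ _ ∷ () ∷ _)   _
predictedWinner-final {1 ∷ 1 ∷ suc _ ∷ _}   _                  ()
predictedWinner-final {1 ∷ suc (suc _) ∷ _} _                  ()
predictedWinner-final {2 ∷ 0 ∷ _}           (_ ∷ () ∷ _)       _
predictedWinner-final {2 ∷ suc _ ∷ _}       _                  ()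

-- Induction on `k`, the number of moves left until the sum is 2.
predictedWinner-wins : ∀ {k ns} → Positive ns → sum ns ≡ 2 + k → Wins (predictedWinner ns) ns
predictedWinner-wins {zero} ps sum≡2 = final (predictedWinner-final ps sum≡2)
predictedWinner-wins {suc k} {ns} ps sum≡ = wins refl refl
  where
  3≤sum : 3 ≤ sum ns
  3≤sum = subst (3 ≤_) (sym sum≡) (s≤s (s≤s (s≤s z≤n)))

  -- The induction hypothesis after a move, which flips the parity of the sum.
  after : ∀ {ms p d} → parity (sum ns) ≡ p → ns ⟶ ms → ∣ signedOdds ms ∣ ≡ d →
          Wins (winner (p ⁻¹) d) ms
  after {ms} refl move refl = subst (λ p → Wins (winner p _) _)
    (sym (trans (cong (λ s → parity s ⁻¹) (sum-⟶ move)) (ℙ.suc-homo-⁻¹ (sum ms))))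
    (predictedWinner-wins (positive-⟶ move ps)
                          (ℕ.suc-injective (trans (sym (sum-⟶ move)) sum≡)))

  toMove : ∀ {p} → parity (sum ns) ≡ p → turn ns ≡ mover p
  toMove = cong mover

  notToMove : ∀ {p q} → parity (sum ns) ≡ p → mover p ≢ q → turn ns ≢ q
  notToMove refl ≢q = ≢q

  parities : ∀ {p d} → parity (sum ns) ≡ p → ∣ signedOdds ns ∣ ≡ d → parity d ≡ p
  parities refl refl = parity-∣signedOdds∣ ns

  wins : ∀ {p d} → parity (sum ns) ≡ p → ∣ signedOdds ns ∣ ≡ d → Wins (winner p d) ns
  wins {1ℙ} {0} eq ∣D∣≡ with () ← parities eq ∣D∣≡
  wins {0ℙ} {1} eq ∣D∣≡ with () ← parities eq ∣D∣≡
  wins {0ℙ} {0} eq ∣D∣≡ = respond 3≤sum (notToMove eq λ ()) reply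
    where
    reply : ∀ {ms} → ns ⟶ ms → Wins White ms
    reply move with ∣signedOdds∣-⟶ move
    ... | inj₁ ∣D′∣≡ = after eq move (trans ∣D′∣≡ (cong suc ∣D∣≡))
    ... | inj₂ ∣D∣≡′ with () ← trans (sym ∣D∣≡′) ∣D∣≡
  wins {1ℙ} {suc (suc d)} eq ∣D∣≡ = respond 3≤sum (notToMove eq λ ()) reply
    where
    reply : ∀ {ms} → ns ⟶ ms → Wins Black ms
    reply move with ∣signedOdds∣-⟶ move
    ... | inj₁ ∣D′∣≡ = after eq move (trans ∣D′∣≡ (cong suc ∣D∣≡))
    -- The new value is `suc d`, and any nonzero value is enough for Black on move.
    ... | inj₂ ∣D∣≡′ = after eq move (ℕ.suc-injective (trans (sym ∣D∣≡′) ∣D∣≡))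
  wins {1ℙ} {1} eq ∣D∣≡ with signedOdds ns in D≡
  wins {1ℙ} {1} eq refl | ℤ.+ 1
    with _ , move , ∣D∣≡′ ← moveFirst ps (ℕ.≤-trans (s≤s z≤n) 3≤sum) =
    choose 3≤sum (toMove eq) move
      (after eq move (trans ∣D∣≡′ (cong (λ z → ∣ ℤ.suc (- z) ∣) D≡)))
  wins {1ℙ} {1} eq refl | -[1+ 0 ] with raise-or-ones ps
  ... | inj₁ (_ , move , D≡′) =
    choose 3≤sum (toMove eq) (move [])
      (after eq (move []) (cong ∣_∣ (trans D≡′ (cong ℤ.suc D≡))))
  -- With all terms 1, Δ would be the sum and could not be negative.
  ... | inj₂ os with () ← trans (sym D≡) (signedOdds-ones os)
  wins {0ℙ} {suc (suc d)} eq ∣D∣≡ with signedOdds ns in D≡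
  wins {0ℙ} {suc (suc d)} eq refl | -[1+ suc d ]
    with _ , move , ∣D∣≡′ ← moveFirst ps (ℕ.≤-trans (s≤s z≤n) 3≤sum) =
    choose 3≤sum (toMove eq) move
      (after eq move (trans ∣D∣≡′ (cong (λ z → ∣ ℤ.suc (- z) ∣) D≡)))
  wins {0ℙ} {suc (suc d)} eq refl | ℤ.+ suc (suc d) with raise-or-ones ps
  ... | inj₁ (_ , move , D≡′) =
    choose 3≤sum (toMove eq) (move [])
      (after eq (move []) (cong ∣_∣ (trans D≡′ (cong ℤ.suc D≡))))
  ... | inj₂ (refl ∷ os) =
    choose 3≤sum (toMove eq) (remove {[]})
      -- The remaining ones have Δ equal to their sum `2 + k`, which is not 1, so White on move
      -- loses.
      (after eq (remove {[]}) (trans (cong ∣_∣ (signedOdds-ones os)) (ℕ.suc-injective sum≡)))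

theorem2p3 : (ns : List ℕ) → All (1 ≤_) ns → 2 ≤ sum ns →
    (Odd (sum ns) → (Wins White ns ⇔ ∣ Δ ns ∣ ≡ 1)) ×
    (Even (sum ns) → (Wins Black ns ⇔ ∣ Δ ns ∣ ≢ 0))
theorem2p3 ns ps 2≤sum rewrite Δ≡signedOdds ns
  with predictedWinner-wins ps (sym (ℕ.m+[n∸m]≡n 2≤sum))
-- Fixing both arguments makes `winner` compute, so the type of `w` names the actual winner in each
-- case.
... | w with parity (sum ns) | ∣ signedOdds ns ∣
... | 0ℙ | 0           = (λ ()) , λ _ →
  mk⇔ (λ b → contradiction (wins-unique w b) λ ()) (λ ≢0 → contradiction refl ≢0)
... | 0ℙ | suc _       = (λ ()) , λ _ → mk⇔ (λ _ ()) (λ _ → w)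
... | 1ℙ | 0           =
  (λ _ → mk⇔ (λ b → contradiction (wins-unique w b) λ ()) (λ ())) , λ ()
... | 1ℙ | 1           = (λ _ → mk⇔ (λ _ → refl) (λ _ → w)) , λ ()
... | 1ℙ | suc (suc _) =
  (λ _ → mk⇔ (λ b → contradiction (wins-unique w b) λ ()) (λ ())) , λ ()
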